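{- Let $s=\{s_1,\dots,s_n\}$ be a sequence of positive integers with associated pair $(\varphi,\epsilon)=\left(n,\tfrac12\sum_{i=1}^n s_i\right)$ such that $s=d(G)$ for some $3$-connected graph $G\in\mathcal{G}_3$. Then $G$ is contained in the entry $p_{\,\epsilon-3\varphi+6,\ \varphi-4}$ of $P_{\mathcal{G}_3}$.
   Context: All graphs are simple (no loops, no parallel edges), undirected and finite; $V_G$ and $E_G$ denote the vertex and edge sets of $G$. A graph $G$ is $3$-connected when there exist at least $3$ internally disjoint paths in $G$ between any two vertices of $G$ (two paths with endpoints $a$ and $b$ are internally disjoint if they share only the vertices $a,b$ and no edges). $\mathcal{G}_3$ is the set of all (unlabelled) $3$-connected simple graphs. The degree sequence $d(G)$ is the monotonic non-increasing sequence of the degrees of the vertices of $G$. The associated pair of $s=\{s_1,\dots,s_n\}$ is $(\varphi(s),\epsilon(s))=\left(n,\tfrac12\sum_{i=1}^n s_i\right)$, abbreviated $(\varphi,\epsilon)$. The partition matrix of $\mathcal{G}_3$ is $P_{\mathcal{G}_3}=(p_{i,j})_{i\in\mathbb{Z},\,j\in\mathbb{N}_0}$, where $p_{i,j}=\{G\in\mathcal{G}_3 \mid |V_G|=j+4 \text{ and } |E_G|=i+3j+6\}$ ($i$ indexes rows and $j$ indexes columns). -}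

module Defs where

open import Data.Fin using (Fin; _<_; _<?_)
open import Data.Integer as ℤ using (ℤ; +_)
open import Data.List using (List; []; _∷_; length; map; filter; allFin; cartesianProduct; sum)
open import Data.List.Membership.Propositional using (_∈_)
open import Data.List.Relation.Unary.Unique.Propositional using (Unique)
import Data.List.Sort as Sort
open import Data.Nat using (ℕ)
open import Data.Nat.Properties using (≤-decTotalOrder)
open import Data.Product using (Σ-syntax; _×_; _,_)
open import Data.Rational as ℚ using (ℚ)
open import Data.Sum using (_⊎_)
open import Level using (0ℓ)
import Relation.Binary.Construct.Flip.EqAndOrd as Flip
open import Relation.Binary using (Rel; Decidable; Symmetric; Irreflexive)
open import Relation.Binary.Construct.Closure.ReflexiveTransitive using (Star; ε; _◅_)
open import Relation.Binary.PropositionalEquality using (_≡_; _≢_)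
open import Relation.Nullary using (¬_)
open import Relation.Nullary.Decidable using (_×-dec_)
open import Relation.Unary using (Pred)

-- Every finite graph is isomorphic to one on some Fin n.  An unlabelled graph
-- (an isomorphism class) is handled through such representatives: a set of
-- unlabelled graphs is a predicate on SimpleGraph, and the ones below
-- mention only isomorphism-invariant data.
record SimpleGraph : Set₁ where
  infix 4 _~_ _~?_
  field
    order  : ℕ
    _~_    : Rel (Fin order) 0ℓ
    _~?_   : Decidable _~_
    ~-sym  : Symmetric _~_
    ~-irr  : Irreflexive _≡_ _~_

  Vertex : Set
  Vertex = Fin order

  vertices : List Vertex
  vertices = allFin order

  -- An undirected edge {u , v} is listed once, as the pair (u , v) with u < v.
  edges : List (Vertex × Vertex)
  edges = filter (λ (u , v) → (u <? v) ×-dec (u ~? v)) (cartesianProduct vertices vertices)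

  degree : Vertex → ℕ
  degree v = length (filter (v ~?_) vertices)

  Walk : Rel Vertex 0ℓ
  Walk = Star _~_

  visited : ∀ {a b} → Walk a b → List Vertex
  visited {a} ε       = a ∷ []
  visited {a} (_ ◅ w) = a ∷ visited w

  steps : ∀ {a b} → Walk a b → List (Vertex × Vertex)
  steps ε                 = []
  steps (_◅_ {i} {j} _ w) = (i , j) ∷ steps w

  record Path (a b : Vertex) : Set where
    field
      walk   : Walk a b
      simple : Unique (visited walk)

  open Path

  OnPath : ∀ {a b} → Vertex → Path a b → Set
  OnPath v p = v ∈ visited (walk p)

  Traverses : ∀ {a b} → Path a b → Vertex → Vertex → Set
  Traverses p u v = (u , v) ∈ steps (walk p) ⊎ (v , u) ∈ steps (walk p)

  InternallyDisjoint : ∀ {a b} → Path a b → Path a b → Set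
  InternallyDisjoint {a} {b} p q =
    (∀ v → OnPath v p → OnPath v q → v ≡ a ⊎ v ≡ b) ×
    (∀ u v → ¬ (Traverses p u v × Traverses q u v))

  -- Edge-disjointness forces the three paths to be distinct.
  ThreeConnected : Set
  ThreeConnected =
    ∀ (a b : Vertex) → a ≢ b →
    Σ[ p ∈ (Fin 3 → Path a b) ] (∀ i j → i ≢ j → InternallyDisjoint (p i) (p j))

∣V∣ ∣E∣ : SimpleGraph → ℕ
∣V∣ G = SimpleGraph.order G
∣E∣ G = length (SimpleGraph.edges G)

-- Sorting with respect to the reversed order ≥.
degreeSequence : SimpleGraph → List ℕ
degreeSequence G = sort (map degree vertices)
  where
  open SimpleGraph G
  open Sort (Flip.decTotalOrder ≤-decTotalOrder) using (sort)

𝒢₃ : Pred SimpleGraph 0ℓ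
𝒢₃ = SimpleGraph.ThreeConnected

φ : List ℕ → ℕ
φ = length

-- Rational, since the sum of an arbitrary sequence may be odd.
ϵ : List ℕ → ℚ
ϵ s = + sum s ℚ./ 2

P𝒢₃ : ℤ → ℕ → Pred SimpleGraph 0ℓ
P𝒢₃ i j G =
  𝒢₃ G ×
  + ∣V∣ G ≡ + j ℤ.+ + 4 ×
  + ∣E∣ G ≡ i ℤ.+ + 3 ℤ.* + j ℤ.+ + 6

{-# OPTIONS --safe #-}
-- The degrees sum to 2|E|, since every edge is counted once at its smaller and
-- once at its larger endpoint; this identifies ϵ s with |E|.  That |V| ≥ 4, so
-- that φ s − 4 is a column index, holds because edge-disjoint paths out of a
-- vertex a have distinct second vertices, all different from a.
module Submission where

open import Defs
open import Data.Bool using (if_then_else_; true; false)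
open import Data.Fin as Fin using (Fin; zero; suc; fromℕ<)
import Data.Fin.Properties as Fin
open import Data.Integer as ℤ using (ℤ; +_)
import Data.Integer.Properties as ℤ
import Data.Integer.Tactic.RingSolver as ℤSolver
open import Data.List using (List; []; _∷_; _++_; length; map; filter; tabulate; cartesianProduct)
import Data.List.Membership.Propositional as List
open import Data.List.Membership.Propositional.Properties using (∈-filter⁻; ∈-map⁺; ∈-allFin)
open import Data.List.Properties using (length-map; length-tabulate; length-++; filter-++; map-tabulate)
open import Data.List.Relation.Binary.Permutation.Propositional using (_↭_; ↭-sym)
open import Data.List.Relation.Binary.Permutation.Propositional.Properties using (↭-length; ∈-resp-↭)
import Data.List.Relation.Unary.All as All
open import Data.List.Relation.Unary.All using (All)
open import Data.List.Relation.Unary.Any using (here)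
import Data.List.Sort as Sort
open import Data.Nat as ℕ using (ℕ)
open import Data.Nat.ListAction using (sum)
open import Data.Nat.ListAction.Properties using (sum-↭)
import Data.Nat.Properties as ℕ
open import Algebra.Properties.CommutativeMonoid.Sum ℕ.+-0-commutativeMonoid
  using (∑-comm; ∑-distrib-+; sum-syntax; sum-cong-≗)
open import Data.Product using (∃-syntax; _×_; _,_; proj₁; proj₂)
open import Data.Rational as ℚ using (ℚ)
open import Data.Rational.Literals using (fromℤ)
import Data.Rational.Properties as ℚ
open import Data.Rational.Unnormalised using (mkℚᵘ; *≡*)
open import Data.Sum using (inj₁)
open import Function using (_∘_; id)
open import Function.Definitions using (Injective)
open import Level using (Level)
open import Relation.Binary using (tri<; tri≈; tri>)
import Relation.Binary.Construct.Flip.EqAndOrd as Flip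
open import Relation.Binary.Construct.Closure.ReflexiveTransitive using (ε; _◅_)
open import Relation.Binary.PropositionalEquality
  using (_≡_; _≢_; refl; sym; trans; cong; cong₂; subst; module ≡-Reasoning)
open import Relation.Nullary using (Dec; does; yes; no; contradiction)
open import Relation.Nullary.Decidable using (_×-dec_; dec-true; dec-false; decidable-stable)
open import Relation.Unary using (Pred; Decidable; _∈_)

private
  variable
    a p : Level
    A B : Set a
    P : Pred A p
    m n : ℕ

open ≡-Reasoning

-- Counting filtered lists by sums of indicators.

𝟙 : {P : Set p} → Dec P → ℕ
𝟙 P? = if does P? then 1 else 0

length-filter-∷ : (P? : Decidable P) (x : A) (xs : List A) →
  length (filter P? (x ∷ xs)) ≡ 𝟙 (P? x) ℕ.+ length (filter P? xs)
length-filter-∷ P? x xs with does (P? x)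
... | true  = refl
... | false = refl

-- Only `id` is needed for `allFin`, but with an arbitrary `f` the induction can pass to `f ∘ suc`;
-- the same holds for the product below.
length-filter-tabulate : (P? : Decidable P) (f : Fin n → A) →
  length (filter P? (tabulate f)) ≡ ∑[ i < n ] 𝟙 (P? (f i))
length-filter-tabulate {n = ℕ.zero}  P? f = refl
length-filter-tabulate {n = ℕ.suc n} P? f = trans
  (length-filter-∷ P? (f zero) (tabulate (f ∘ suc)))
  (cong (𝟙 (P? (f zero)) ℕ.+_) (length-filter-tabulate P? (f ∘ suc)))

length-filter-map : (P? : Decidable P) (f : B → A) (xs : List B) →
  length (filter P? (map f xs)) ≡ length (filter (P? ∘ f) xs)
length-filter-map P? f [] = refl
length-filter-map P? f (x ∷ xs) with does (P? (f x))
... | true  = cong ℕ.suc (length-filter-map P? f xs)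
... | false = length-filter-map P? f xs

length-filter-cartesianProduct :
  {P : Pred (A × B) p} (P? : Decidable P) (f : Fin m → A) (g : Fin n → B) →
  length (filter P? (cartesianProduct (tabulate f) (tabulate g))) ≡
  ∑[ i < m ] ∑[ j < n ] 𝟙 (P? (f i , g j))
length-filter-cartesianProduct {m = ℕ.zero} P? f g = refl
length-filter-cartesianProduct {m = ℕ.suc m} {n = n} P? f g = begin
  length (filter P? (row ++ rest))
    ≡⟨ cong length (filter-++ P? row rest) ⟩
  length (filter P? row ++ filter P? rest)
    ≡⟨ length-++ (filter P? row) ⟩
  length (filter P? row) ℕ.+ length (filter P? rest)
    ≡⟨ cong₂ ℕ._+_
         (trans (length-filter-map P? (f zero ,_) (tabulate g))
                (length-filter-tabulate (P? ∘ (f zero ,_)) g))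
         (length-filter-cartesianProduct P? (f ∘ suc) g) ⟩
  ∑[ i < ℕ.suc m ] ∑[ j < n ] 𝟙 (P? (f i , g j)) ∎
  where
  row  = map (f zero ,_) (tabulate g)
  rest = cartesianProduct (tabulate (f ∘ suc)) (tabulate g)

sum-tabulate : (f : Fin n → ℕ) → sum (tabulate f) ≡ ∑[ i < n ] f i
sum-tabulate {n = ℕ.zero}  f = refl
sum-tabulate {n = ℕ.suc n} f = cong (f zero ℕ.+_) (sum-tabulate (f ∘ suc))

filter-nonempty : (P? : Decidable P) (xs : List A) →
  length (filter P? xs) ℕ.> 0 → ∃[ x ] P x
filter-nonempty {P = P} P? xs = go (filter P? xs) (λ x∈ → proj₂ (∈-filter⁻ P? {xs = xs} x∈))
  where
  -- The filtered list is generalised to any list of elements satisfying `P`, so that its shape can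
  -- be matched on.
  go : ∀ ys → (∀ {x} → x List.∈ ys → P x) → length ys ℕ.> 0 → ∃[ x ] P x
  go (x ∷ _) all _ = x , all (here refl)

module _ (G : SimpleGraph) where
  open SimpleGraph G
  open Path

  -- Degree sum and number of edges.

  private
    _<~?_ : ∀ u v → Dec (u Fin.< v × u ~ v)
    u <~? v = (u Fin.<? v) ×-dec (u ~? v)

  -- Adjacent vertices are distinct by irreflexivity, so exactly one of `u < v` and `v < u` holds;
  -- symmetry rules out adjacency in one direction only.
  𝟙-adjacent : ∀ u v → 𝟙 (u ~? v) ≡ 𝟙 (u <~? v) ℕ.+ 𝟙 (v <~? u)
  𝟙-adjacent u v with u ~? v | v ~? u | Fin.<-cmp u v
  ... | yes u~v | no ¬v~u | _ = contradiction (~-sym u~v) ¬v~u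
  ... | no ¬u~v | yes v~u | _ = contradiction (~-sym v~u) ¬u~v
  ... | yes u~v | yes _ | tri≈ _ u≡v _ = contradiction u~v (~-irr u≡v)
  ... | yes _ | yes _ | tri< u<v _ v≮u
    rewrite dec-true (u Fin.<? v) u<v | dec-false (v Fin.<? u) v≮u = refl
  ... | yes _ | yes _ | tri> u≮v _ v<u
    rewrite dec-false (u Fin.<? v) u≮v | dec-true (v Fin.<? u) v<u = refl
  -- Both summands are 0, but the conjunction evaluates the order test first and reduces only once
  -- that is known.
  ... | no _ | no _ | _ with does (u Fin.<? v) | does (v Fin.<? u)
  ... | true  | true  = refl
  ... | true  | false = refl
  ... | false | true  = refl
  ... | false | false = refl

  ∣E∣-∑ : ∣E∣ G ≡ ∑[ u < order ] ∑[ v < order ] 𝟙 (u <~? v)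
  ∣E∣-∑ = length-filter-cartesianProduct (λ (u , v) → u <~? v) id id

  handshake : sum (map degree vertices) ≡ ∣E∣ G ℕ.* 2
  handshake = begin
    sum (map degree vertices)
      ≡⟨ cong sum (map-tabulate id degree) ⟩
    sum (tabulate degree)
      ≡⟨ sum-tabulate degree ⟩
    ∑[ u < order ] degree u
      ≡⟨ sum-cong-≗ (λ u → trans (length-filter-tabulate (u ~?_) id)
                               (sum-cong-≗ (𝟙-adjacent u))) ⟩
    ∑[ u < order ] ∑[ v < order ] (𝟙 (u <~? v) ℕ.+ 𝟙 (v <~? u))
      ≡⟨ sum-cong-≗ (λ u → ∑-distrib-+ (λ v → 𝟙 (u <~? v)) (λ v → 𝟙 (v <~? u))) ⟩
    ∑[ u < order ] (∑[ v < order ] 𝟙 (u <~? v) ℕ.+ ∑[ v < order ] 𝟙 (v <~? u))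
      ≡⟨ ∑-distrib-+ (λ u → ∑[ v < order ] 𝟙 (u <~? v)) (λ u → ∑[ v < order ] 𝟙 (v <~? u)) ⟩
    ∑[ u < order ] ∑[ v < order ] 𝟙 (u <~? v) ℕ.+ ∑[ u < order ] ∑[ v < order ] 𝟙 (v <~? u)
      -- Exchanging the sums turns the count of edges at their larger endpoint into the count at
      -- their smaller one.
      ≡⟨ cong (∑[ u < order ] ∑[ v < order ] 𝟙 (u <~? v) ℕ.+_)
           (∑-comm (λ u v → 𝟙 (v <~? u))) ⟩
    ∑[ u < order ] ∑[ v < order ] 𝟙 (u <~? v) ℕ.+ ∑[ u < order ] ∑[ v < order ] 𝟙 (u <~? v)
      ≡⟨ cong₂ ℕ._+_ ∣E∣-∑ ∣E∣-∑ ⟨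
    ∣E∣ G ℕ.+ ∣E∣ G
      ≡⟨ cong (∣E∣ G ℕ.+_) (ℕ.+-identityʳ (∣E∣ G)) ⟨
    2 ℕ.* ∣E∣ G
      ≡⟨ ℕ.*-comm 2 (∣E∣ G) ⟩
    ∣E∣ G ℕ.* 2 ∎

  -- At least four vertices.

  firstStep : ∀ {a b} → a ≢ b → (w : Walk a b) →
    ∃[ x ] a ~ x × (a , x) List.∈ steps w
  firstStep a≢b ε         = contradiction refl a≢b
  firstStep a≢b (a~x ◅ w) = _ , a~x , here refl

  threeConnected⇒4≤∣V∣ : ThreeConnected → ∀ {a b : Vertex} → a ≢ b → 4 ℕ.≤ ∣V∣ G
  threeConnected⇒4≤∣V∣ connected {a} {b} a≢b = Fin.injective⇒≤ f-injective
    where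
    paths = proj₁ (connected a b a≢b)
    disjoint = proj₂ (connected a b a≢b)
    first = λ i → firstStep a≢b (walk (paths i))

    second : Fin 3 → Vertex
    second = proj₁ ∘ first

    second≢a : ∀ i → second i ≢ a
    second≢a i x≡a = ~-irr (sym x≡a) (proj₁ (proj₂ (first i)))

    second-injective : ∀ {i j} → second i ≡ second j → i ≡ j
    second-injective {i} {j} eq = decidable-stable (i Fin.≟ j) λ i≢j →
      -- Edge-disjointness is the half to use: a common second vertex could be `b`, where the paths
      -- may meet, but then both would traverse the edge from `a` to it.
      proj₂ (disjoint i j i≢j) a (second i)
        ( inj₁ (proj₂ (proj₂ (first i)))
        , inj₁ (subst (λ x → (a , x) List.∈ steps (walk (paths j))) (sym eq)
                      (proj₂ (proj₂ (first j)))) )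

    f : Fin 4 → Vertex
    f zero    = a
    f (suc i) = second i

    f-injective : Injective _≡_ _≡_ f
    f-injective {zero}  {zero}  _  = refl
    f-injective {zero}  {suc j} eq = contradiction (sym eq) (second≢a j)
    f-injective {suc i} {zero}  eq = contradiction eq (second≢a i)
    f-injective {suc i} {suc j} eq = cong suc (second-injective eq)

  -- The associated pair of the degree sequence.

  degreeSequence-↭ : degreeSequence G ↭ map degree vertices
  degreeSequence-↭ = Sort.sort-↭ (Flip.decTotalOrder ℕ.≤-decTotalOrder) (map degree vertices)

  φ-degreeSequence : φ (degreeSequence G) ≡ ∣V∣ G
  φ-degreeSequence = begin
    length (degreeSequence G)     ≡⟨ ↭-length degreeSequence-↭ ⟩
    length (map degree vertices)  ≡⟨ length-map degree vertices ⟩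
    length vertices               ≡⟨ length-tabulate id ⟩
    order                         ∎

  ϵ-degreeSequence : ϵ (degreeSequence G) ≡ fromℤ (+ ∣E∣ G)
  ϵ-degreeSequence = begin
    + sum (degreeSequence G) ℚ./ 2
      ≡⟨ cong (λ k → + k ℚ./ 2) (trans (sum-↭ degreeSequence-↭) handshake) ⟩
    + (∣E∣ G ℕ.* 2) ℚ./ 2
      -- `mkℚᵘ` stores the denominator minus one, so these are 2|E|/2 and |E|/1, compared by
      -- cross-multiplication.
      ≡⟨ ℚ.fromℚᵘ-cong {mkℚᵘ (+ (∣E∣ G ℕ.* 2)) 1} {mkℚᵘ (+ ∣E∣ G) 0}
           (*≡* (trans (ℤ.*-identityʳ _) (ℤ.pos-* (∣E∣ G) 2))) ⟩
    + ∣E∣ G ℚ./ 1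
      ≡⟨ ℚ.↥p/↧p≡p (fromℤ (+ ∣E∣ G)) ⟩
    fromℤ (+ ∣E∣ G) ∎

  -- `ThreeConnected` is vacuous on a single vertex. A nonempty sequence supplies a vertex, and its
  -- positive degree a neighbour, which differs from it by irreflexivity.
  positiveDegrees⇒4≤∣V∣ : degreeSequence G ≢ [] → All (ℕ._> 0) (degreeSequence G) →
    ThreeConnected → 4 ℕ.≤ ∣V∣ G
  positiveDegrees⇒4≤∣V∣ s≢[] s>0 connected =
    threeConnected⇒4≤∣V∣ connected (λ v≡w → ~-irr v≡w (proj₂ neighbour))
    where
    nonempty⇒0<length : ∀ {xs : List ℕ} → xs ≢ [] → 0 ℕ.< length xs
    nonempty⇒0<length {[]}    xs≢[] = contradiction refl xs≢[]
    nonempty⇒0<length {_ ∷ _} _     = ℕ.z<s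

    v : Vertex
    v = fromℕ< (subst (0 ℕ.<_) φ-degreeSequence (nonempty⇒0<length s≢[]))

    neighbour : ∃[ w ] v ~ w
    neighbour = filter-nonempty (v ~?_) vertices
      (All.lookup s>0 (∈-resp-↭ (↭-sym degreeSequence-↭) (∈-map⁺ degree (∈-allFin v))))

-- The integers inside the rationals.

fromℤ-+ : ∀ i j → fromℤ i ℚ.+ fromℤ j ≡ fromℤ (i ℤ.+ j)
-- Rational addition cross-multiplies by the denominators, leaving factors 1 to remove from the
-- numerator.
fromℤ-+ i j = trans (cong (ℚ._/ 1) (cong₂ ℤ._+_ (ℤ.*-identityʳ i) (ℤ.*-identityʳ j)))
  (ℚ.↥p/↧p≡p (fromℤ (i ℤ.+ j)))

fromℤ-* : ∀ i j → fromℤ i ℚ.* fromℤ j ≡ fromℤ (i ℤ.* j)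
fromℤ-* i j = ℚ.↥p/↧p≡p (fromℤ (i ℤ.* j))

-- Rational negation is defined by cases on the numerator, so it computes only after the same split.
fromℤ-neg : ∀ i → ℚ.- fromℤ i ≡ fromℤ (ℤ.- i)
fromℤ-neg (+ 0)      = refl
fromℤ-neg ℤ.+[1+ _ ] = refl
fromℤ-neg ℤ.-[1+ _ ] = refl

lemma6p2 : (s : List ℕ) → s ≢ [] → All (ℕ._> 0) s →
    (G : SimpleGraph) → G ∈ 𝒢₃ → s ≡ degreeSequence G →
    ∃[ i ] ∃[ j ]
    (fromℤ i ≡ ϵ s ℚ.- fromℤ (+ 3) ℚ.* fromℤ (+ φ s) ℚ.+ fromℤ (+ 6)) ×
    (+ j ≡ + φ s ℤ.- + 4) ×
    (G ∈ P𝒢₃ i j)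
lemma6p2 s s≢[] s>0 G connected refl = i , j , sym row , sym column , connected , order-eq , size-eq
  where
  V = + φ s
  E = + ∣E∣ G
  -- The required row with the integer |E| in place of the rational `ϵ s`.
  i = E ℤ.- + 3 ℤ.* V ℤ.+ + 6
  -- Truncated subtraction, which agrees with integer subtraction because of `4≤φ`.
  j = φ s ℕ.∸ 4

  row : ϵ s ℚ.- fromℤ (+ 3) ℚ.* fromℤ V ℚ.+ fromℤ (+ 6) ≡ fromℤ i
  row = begin
    ϵ s ℚ.- fromℤ (+ 3) ℚ.* fromℤ V ℚ.+ fromℤ (+ 6)
      ≡⟨ cong₂ (λ e x → e ℚ.- x ℚ.+ fromℤ (+ 6)) (ϵ-degreeSequence G) (fromℤ-* (+ 3) V) ⟩
    fromℤ E ℚ.- fromℤ (+ 3 ℤ.* V) ℚ.+ fromℤ (+ 6)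
      ≡⟨ cong (λ x → fromℤ E ℚ.+ x ℚ.+ fromℤ (+ 6)) (fromℤ-neg (+ 3 ℤ.* V)) ⟩
    fromℤ E ℚ.+ fromℤ (ℤ.- (+ 3 ℤ.* V)) ℚ.+ fromℤ (+ 6)
      ≡⟨ cong (ℚ._+ fromℤ (+ 6)) (fromℤ-+ E (ℤ.- (+ 3 ℤ.* V))) ⟩
    fromℤ (E ℤ.- + 3 ℤ.* V) ℚ.+ fromℤ (+ 6)
      ≡⟨ fromℤ-+ (E ℤ.- + 3 ℤ.* V) (+ 6) ⟩
    fromℤ i ∎

  4≤φ : 4 ℕ.≤ φ s
  4≤φ = subst (4 ℕ.≤_) (sym (φ-degreeSequence G)) (positiveDegrees⇒4≤∣V∣ G s≢[] s>0 connected)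

  column : V ℤ.- + 4 ≡ + j
  column = trans (ℤ.m-n≡m⊖n (φ s) 4) (ℤ.⊖-≥ 4≤φ)

  order-eq : + ∣V∣ G ≡ + j ℤ.+ + 4
  order-eq = cong +_ (sym (trans (ℕ.m∸n+n≡m 4≤φ) (φ-degreeSequence G)))

  -- The constants cancel as 6 - 12 + 6 = 0. The column is kept as an integer difference for the
  -- ring solver, and `column` then replaces it by `j`.
  size-identity : ∀ e v → e ≡ (e ℤ.- + 3 ℤ.* v ℤ.+ + 6) ℤ.+ + 3 ℤ.* (v ℤ.- + 4) ℤ.+ + 6
  size-identity = ℤSolver.solve-∀

  size-eq : E ≡ i ℤ.+ + 3 ℤ.* + j ℤ.+ + 6
  size-eq = trans (size-identity E V) (cong (λ c → i ℤ.+ + 3 ℤ.* c ℤ.+ + 6) column)
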